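{- Let $k\ge 1$ and $n\ge 1$ be integers and let $T_n$ be any tree with $n$ vertices. If the vertices of $T_n$ are colored uniformly and independently with $k$ colors, the expected number of blocks is $$\mathbb{E}[X_{k}(T_n)] = \frac{(k-1)n+1}{k}.$$
   Context: Given a coloring of the vertices of a finite graph $G$ with $k$ colors, the blocks are the connected components of the subgraph of $G$ formed by all vertices and all edges whose two endpoints have the same color. $X_k(G)$ denotes the number of blocks when each vertex of $G$ receives independently a uniformly random color among $k$ colors. -}

module Defs where

open import Level using (0ℓ; suc)
open import Data.Bool.Properties using () renaming (_≟_ to _≟ᵇ_)
open import Data.Fin.Base using (Fin; finToFun)
open import Data.Fin.Properties using () renaming (_≟_ to _≟ᶠ_)
open import Data.Fin.Subset using (Subset)
open import Data.Integer.Base using (+_)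
open import Data.List.Base using (List; []; _∷_; _++_; [_]; length; map; allFin; deduplicate)
open import Data.List.Membership.Propositional using (_∈_)
open import Data.List.Membership.Propositional.Properties using (∈-allFin)
open import Data.List.Relation.Unary.Any using (here; there)
open import Data.List.Relation.Unary.Linked using (Linked)
open import Data.List.Relation.Unary.Unique.Propositional using (Unique)
open import Data.Nat.Base using (ℕ; NonZero; _≤_; _^_)
open import Data.Product.Base using (_×_; _,_)
open import Data.Rational.Base using (ℚ; _/_; _*_)
open import Data.Rational.Properties using (+-0-monoid; *-1-monoid)
open import Data.Sum.Base using (_⊎_; inj₁; inj₂)
open import Data.Vec.Base using (tabulate)
open import Data.Vec.Properties using (≡-dec)
open import Relation.Binary.Construct.Closure.ReflexiveTransitive using (Star; ε; _◅_; _◅◅_)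
open import Relation.Binary.Core using (Rel)
open import Relation.Binary.Definitions using (Decidable; Symmetric; Irreflexive)
open import Relation.Binary.PropositionalEquality.Core using (_≡_; refl; sym)
open import Relation.Nullary.Decidable using (does; map′; _×-dec_; _⊎-dec_)
open import Relation.Nullary.Negation using (¬_)
import Algebra.Properties.Monoid.Sum as MonoidSum

record Graph (n : ℕ) : Set (suc 0ℓ) where
  field
    Adj    : Rel (Fin n) 0ℓ
    adj?   : Decidable Adj
    symm   : Symmetric Adj
    irrefl : Irreflexive _≡_ Adj

open Graph public

Reachable : ∀ {n} → Graph n → Rel (Fin n) 0ℓ
Reachable G = Star (Adj G)

Connected : ∀ {n} → Graph n → Set
Connected G = ∀ u v → Reachable G u v

-- x ∷ xs lists the vertices of a cycle, traversed once; the last is joined to x.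
IsCycle : ∀ {n} → Graph n → Fin n → List (Fin n) → Set
IsCycle G x xs = 3 ≤ length (x ∷ xs) × Unique (x ∷ xs) × Linked (Adj G) (x ∷ xs ++ [ x ])

Acyclic : ∀ {n} → Graph n → Set
Acyclic G = ∀ x xs → ¬ IsCycle G x xs

-- The null graph also satisfies IsTree; nonemptiness is to be assumed separately.
IsTree : ∀ {n} → Graph n → Set
IsTree G = Connected G × Acyclic G

-- Reachability is decided by the Floyd–Warshall recursion: Via ws u v says that
-- v can be reached from u through intermediate vertices taken from ws.
module _ {n : ℕ} (G : Graph n) where

  private
    Via : List (Fin n) → Rel (Fin n) 0ℓ
    Via []       u v = u ≡ v ⊎ Adj G u v
    Via (w ∷ ws) u v = Via ws u v ⊎ (Via ws u w × Via ws w v)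

    via? : ∀ ws → Decidable (Via ws)
    via? []       u v = (u ≟ᶠ v) ⊎-dec adj? G u v
    via? (w ∷ ws) u v = via? ws u v ⊎-dec (via? ws u w ×-dec via? ws w v)

    via⇒reachable : ∀ ws {u v} → Via ws u v → Reachable G u v
    via⇒reachable []       (inj₁ refl)    = ε
    via⇒reachable []       (inj₂ e)       = e ◅ ε
    via⇒reachable (w ∷ ws) (inj₁ p)       = via⇒reachable ws p
    via⇒reachable (w ∷ ws) (inj₂ (p , q)) = via⇒reachable ws p ◅◅ via⇒reachable ws q

    via-base : ∀ ws {u v} → Via [] u v → Via ws u v
    via-base []       p = p
    via-base (w ∷ ws) p = inj₁ (via-base ws p)

    via-to : ∀ {w} ws {u} → Via (w ∷ ws) u w → Via ws u w
    via-to ws (inj₁ p)       = p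
    via-to ws (inj₂ (p , _)) = p

    via-from : ∀ {w} ws {v} → Via (w ∷ ws) w v → Via ws w v
    via-from ws (inj₁ p)       = p
    via-from ws (inj₂ (_ , q)) = q

    via-trans : ∀ ws {u w v} → w ∈ ws → Via ws u w → Via ws w v → Via ws u v
    via-trans (x ∷ xs) (here refl) p q = inj₂ (via-to xs p , via-from xs q)
    via-trans (x ∷ xs) (there m) (inj₁ p)       (inj₁ q)       = inj₁ (via-trans xs m p q)
    via-trans (x ∷ xs) (there m) (inj₁ p)       (inj₂ (q , r)) = inj₂ (via-trans xs m p q , r)
    via-trans (x ∷ xs) (there m) (inj₂ (p , q)) (inj₁ r)       = inj₂ (p , via-trans xs m q r)
    via-trans (x ∷ xs) (there m) (inj₂ (p , _)) (inj₂ (_ , r)) = inj₂ (p , r)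

    reachable⇒via : ∀ {u v} → Reachable G u v → Via (allFin n) u v
    reachable⇒via ε                 = via-base (allFin n) (inj₁ refl)
    reachable⇒via (_◅_ {j = w} e p) =
      via-trans (allFin n) (∈-allFin w) (via-base (allFin n) (inj₂ e)) (reachable⇒via p)

  reachable? : Decidable (Reachable G)
  reachable? u v = map′ (via⇒reachable (allFin n)) reachable⇒via (via? (allFin n) u v)

component : ∀ {n} → Graph n → Fin n → Subset n
component G v = tabulate λ u → does (reachable? G v u)

components : ∀ {n} → Graph n → List (Subset n)
components {n} G = deduplicate (≡-dec _≟ᵇ_) (map (component G) (allFin n))

Coloring : ℕ → ℕ → Set
Coloring n k = Fin n → Fin k

monochromatic : ∀ {n k} → Graph n → Coloring n k → Graph n
monochromatic G c .Adj u v           = Adj G u v × c u ≡ c v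
monochromatic G c .adj? u v          = adj? G u v ×-dec (c u ≟ᶠ c v)
monochromatic G c .symm (e , p)      = symm G e , sym p
monochromatic G c .irrefl eq (e , _) = irrefl G eq e

blocks : ∀ {n k} → Graph n → Coloring n k → List (Subset n)
blocks G c = components (monochromatic G c)

X : ∀ {n} k → Graph n → Coloring n k → ℕ
X k G c = length (blocks G c)

∑ : ∀ {m} → (Fin m → ℚ) → ℚ
∑ = MonoidSum.sum +-0-monoid

∏ : ∀ {m} → (Fin m → ℚ) → ℚ
∏ = MonoidSum.sum *-1-monoid

uniform : ∀ k .{{_ : NonZero k}} → Fin k → ℚ
uniform k _ = + 1 / k

-- The product measure: colors of distinct vertices are independent.
probability : ∀ {n} k .{{_ : NonZero k}} → Coloring n k → ℚ
probability k c = ∏ λ v → uniform k (c v)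

-- Every coloring is enumerated exactly once, up to pointwise equality.
coloring : ∀ n k → Fin (k ^ n) → Coloring n k
coloring n k = finToFun {k} {n}

𝔼 : ∀ {n} k .{{_ : NonZero k}} → (Coloring n k → ℕ) → ℚ
𝔼 {n} k f = ∑ λ i → probability k (coloring n k i) * (+ f (coloring n k i) / 1)

{-# OPTIONS --safe #-}
module Submission where

-- Grow the tree from a root by attaching leaves one at a time; acyclicity makes each new leaf adjacent
-- to exactly one earlier vertex.  For a fixed coloring a new leaf starts a new block unless its edge is
-- monochromatic, so #blocks + #monochromatic edges = n.  Averaging over colorings, each of the n − 1
-- edges is monochromatic with probability 1/k, whence the expectation is n − (n − 1)/k.

open import Defs
open import Algebra.Bundles using (CommutativeMonoid)
open import Data.Bool.Base using (true; if_then_else_)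
open import Data.Bool.Properties using () renaming (_≟_ to _≟ᵇ_)
open import Data.Fin.Base using (Fin; zero; suc; combine; _↑ˡ_; _↑ʳ_)
open import Data.Fin.Properties using (_≟_; remQuot-combine; all?; ¬∀⟶∃¬)
open import Data.Integer.Base using (+_; _+_; _-_; _*_)
import Data.Integer.Properties as ℤ
open import Data.List.Base using (List; []; _∷_; [_]; _++_; length; map; allFin; filter)
open import Data.List.Membership.DecPropositional using () renaming (_∈?_ to ∈?)
open import Data.List.Membership.Propositional using (_∈_; _∉_)
open import Data.List.Membership.Propositional.Properties
  using (∈-allFin; ∈-filter⁺; ∈-filter⁻; ∈-map⁺; ∈-map⁻; ∈-++⁻; ∈-deduplicate⁺; ∈-deduplicate⁻)
open import Data.List.Membership.Propositional.Properties.WithK using (unique∧set⇒bag)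
open import Data.List.Properties using (length-map; length-tabulate; length-filter)
open import Data.List.Relation.Binary.BagAndSetEquality using (∼bag⇒↭)
open import Data.List.Relation.Binary.Permutation.Propositional.Properties using (↭-length)
open import Data.List.Relation.Unary.All as All using ([]; _∷_)
open import Data.List.Relation.Unary.All.Properties using (¬Any⇒All¬)
open import Data.List.Relation.Unary.AllPairs using ([]; _∷_)
open import Data.List.Relation.Unary.Any using (here; there)
open import Data.List.Relation.Unary.Linked using (Linked; [-]; _∷_)
open import Data.List.Relation.Unary.Unique.DecPropositional.Properties using (deduplicate-!)
open import Data.List.Relation.Unary.Unique.Propositional using (Unique)
open import Data.List.Relation.Unary.Unique.Propositional.Properties using (allFin⁺; filter⁺; ++⁺)
open import Data.Nat.Base as ℕ using (ℕ; zero; suc; NonZero; _^_; _≤_; _<_; z≤n; s≤s)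
import Data.Nat.ListAction as ListAction
open import Data.Nat.Properties as ℕ using (+-*-semiring)
open import Data.Nat.Tactic.RingSolver using (solve-∀)
open import Data.Product.Base using (_×_; _,_; proj₁; proj₂; ∃; ∃₂; uncurry)
open import Data.Rational.Base as ℚ using (ℚ; _/_; toℚᵘ; fromℚᵘ; 1ℚ)
import Data.Rational.Properties as ℚ
open import Data.Rational.Unnormalised.Base as ℚᵘ using (mkℚᵘ; *≡*)
import Data.Rational.Unnormalised.Properties as ℚᵘ
open import Data.Sum.Base using ([_,_]′)
open import Data.Vec.Base using (lookup)
open import Data.Vec.Functional using (Vector; updateAt)
open import Data.Vec.Functional.Properties using (updateAt-updates; updateAt-minimal)
open import Data.Vec.Properties using (≡-dec; tabulate-cong; lookup∘tabulate)
open import Function.Base using (_∘_; const; id)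
open import Function.Bundles using (mk⇔)
open import Relation.Binary.Construct.Closure.ReflexiveTransitive using (ε; _◅_; _◅◅_; reverse)
open import Relation.Binary.PropositionalEquality
  using (_≡_; _≢_; refl; sym; trans; cong; cong₂; subst; subst₂; module ≡-Reasoning)
open import Relation.Nullary.Decidable using (Dec; yes; no; does; does-⇔; dec-true)
open import Relation.Nullary.Negation using (contradiction)
open import Algebra.Properties.CommutativeSemigroup
  (CommutativeMonoid.commutativeSemigroup ℚ.*-1-commutativeMonoid) using (interchange)
open import Algebra.Properties.Semiring.Sum +-*-semiring
  using (sum; sum-syntax; sum-cong-≗; ∑-comm; ∑-distrib-+)

open ≡-Reasoning

-- Finite sums of natural numbers.

sum-const : ∀ n x → sum {n} (λ _ → x) ≡ n ℕ.* x
sum-const zero    x = refl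
sum-const (suc n) x = cong (x ℕ.+_) (sum-const n x)

sum-splitAt : ∀ m {n} (f : Vector ℕ (m ℕ.+ n)) →
  sum f ≡ sum (λ i → f (i ↑ˡ n)) ℕ.+ sum (λ j → f (m ↑ʳ j))
sum-splitAt zero    f = refl
sum-splitAt (suc m) f =
  trans (cong (f zero ℕ.+_) (sum-splitAt m (f ∘ suc))) (sym (ℕ.+-assoc (f zero) _ _))

-- Used with an index of type `Fin (k ^ suc n)`, which splits into the color of vertex `zero` and
-- the index of a coloring of the remaining vertices.
sum-combine : ∀ m {n} (f : Vector ℕ (m ℕ.* n)) →
  sum f ≡ ∑[ i < m ] ∑[ j < n ] f (combine i j)
sum-combine zero        f = refl
sum-combine (suc m) {n} f =
  trans (sum-splitAt n f) (cong (sum (λ j → f (j ↑ˡ (m ℕ.* n))) ℕ.+_) (sum-combine m (λ j → f (n ↑ʳ j))))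

-- Counting colorings in which two vertices agree.

⟦_≟_⟧ : ∀ {k} → Fin k → Fin k → ℕ
⟦ a ≟ b ⟧ = if does (a ≟ b) then 1 else 0

sum-⟦≟⟧ : ∀ {k} (b : Fin k) → ∑[ a < k ] ⟦ a ≟ b ⟧ ≡ 1
sum-⟦≟⟧ {suc k} zero    = cong suc (trans (sum-const k 0) (ℕ.*-zeroʳ k))
sum-⟦≟⟧ {suc k} (suc b) = sum-⟦≟⟧ b

⟦≟⟧-comm : ∀ {k} (a b : Fin k) → ⟦ a ≟ b ⟧ ≡ ⟦ b ≟ a ⟧
⟦≟⟧-comm zero    zero    = refl
⟦≟⟧-comm zero    (suc b) = refl
⟦≟⟧-comm (suc a) zero    = refl
⟦≟⟧-comm (suc a) (suc b) = ⟦≟⟧-comm a b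

-- Left unnormalised: all colorings have the same weight, so the counting can stay in `ℕ` and the
-- division comes at the end.
∑ᶜ : ∀ {n} k → (Coloring n k → ℕ) → ℕ
∑ᶜ {n} k f = sum (λ i → f (coloring n k i))

module _ {n k : ℕ} (a : Fin k) (i : Fin (k ^ n)) where
  coloring-zero : coloring (suc n) k (combine a i) zero ≡ a
  coloring-zero = cong proj₁ (remQuot-combine {k} {k ^ n} a i)

  coloring-suc : ∀ v → coloring (suc n) k (combine a i) (suc v) ≡ coloring n k i v
  coloring-suc v = cong (λ r → coloring n k (proj₂ r) v) (remQuot-combine {k} {k ^ n} a i)

-- Once the other `n` vertices are colored, exactly one color of vertex `zero` matches that of
-- `suc v`; exchanging the two sums leaves one match for each of the `k ^ n` colorings.
∑ᶜ-⟦≟⟧-zero : ∀ {n} k (v : Fin n) → ∑ᶜ k (λ c → ⟦ c zero ≟ c (suc v) ⟧) ≡ k ^ n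
∑ᶜ-⟦≟⟧-zero {n} k v = begin
  ∑ᶜ k (λ c → ⟦ c zero ≟ c (suc v) ⟧)
    ≡⟨ sum-combine k _ ⟩
  ∑[ a < k ] ∑[ i < k ^ n ] ⟦ coloring (suc n) k (combine a i) zero ≟ coloring (suc n) k (combine a i) (suc v) ⟧
    ≡⟨ sum-cong-≗ {k} (λ a → sum-cong-≗ {k ^ n} λ i → cong₂ ⟦_≟_⟧ (coloring-zero {n} a i) (coloring-suc a i v)) ⟩
  ∑[ a < k ] ∑[ i < k ^ n ] ⟦ a ≟ coloring n k i v ⟧
    ≡⟨ ∑-comm {k} {k ^ n} _ ⟩
  ∑[ i < k ^ n ] ∑[ a < k ] ⟦ a ≟ coloring n k i v ⟧
    ≡⟨ sum-cong-≗ (λ i → sum-⟦≟⟧ (coloring n k i v)) ⟩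
  ∑[ i < k ^ n ] 1
    ≡⟨ trans (sum-const (k ^ n) 1) (ℕ.*-identityʳ (k ^ n)) ⟩
  k ^ n ∎

-- Two distinct vertices agree with probability 1/k, denominators cleared. If neither vertex is
-- `zero`, the color of `zero` is free and contributes a factor `k`.
∑ᶜ-⟦≟⟧ : ∀ {n} k {u v : Fin n} → u ≢ v → k ℕ.* ∑ᶜ k (λ c → ⟦ c u ≟ c v ⟧) ≡ k ^ n
∑ᶜ-⟦≟⟧ k {zero}  {zero}  u≢v = contradiction refl u≢v
∑ᶜ-⟦≟⟧ k {zero}  {suc v} u≢v = cong (k ℕ.*_) (∑ᶜ-⟦≟⟧-zero k v)
∑ᶜ-⟦≟⟧ {suc n} k {suc u} {zero}  u≢v = cong (k ℕ.*_)
  (trans (sum-cong-≗ λ i → ⟦≟⟧-comm (coloring (suc n) k i (suc u)) (coloring (suc n) k i zero)) (∑ᶜ-⟦≟⟧-zero k u))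
∑ᶜ-⟦≟⟧ {suc n} k {suc u} {suc v} u≢v = cong (k ℕ.*_) (begin
  ∑ᶜ k (λ c → ⟦ c (suc u) ≟ c (suc v) ⟧)
    ≡⟨ sum-combine k _ ⟩
  ∑[ a < k ] ∑[ i < k ^ n ] ⟦ coloring (suc n) k (combine a i) (suc u) ≟ coloring (suc n) k (combine a i) (suc v) ⟧
    ≡⟨ sum-cong-≗ {k} (λ a → sum-cong-≗ {k ^ n} λ i → cong₂ ⟦_≟_⟧ (coloring-suc a i u) (coloring-suc a i v)) ⟩
  ∑[ a < k ] ∑ᶜ k (λ c → ⟦ c u ≟ c v ⟧)
    ≡⟨ sum-const k _ ⟩
  k ℕ.* ∑ᶜ k (λ c → ⟦ c u ≟ c v ⟧)
    ≡⟨ ∑ᶜ-⟦≟⟧ k (u≢v ∘ cong suc) ⟩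
  k ^ n ∎)

-- Lengths of duplicate-free lists.

unique∧set⇒length : ∀ {A : Set} {xs ys : List A} → Unique xs → Unique ys →
  (∀ {z} → z ∈ xs → z ∈ ys) → (∀ {z} → z ∈ ys → z ∈ xs) → length xs ≡ length ys
unique∧set⇒length xs! ys! xs⊆ys ys⊆xs = ↭-length (∼bag⇒↭ (unique∧set⇒bag xs! ys! (mk⇔ xs⊆ys ys⊆xs)))

length-allFin : ∀ n → length (allFin n) ≡ n
length-allFin n = length-tabulate id

unique⇒length≤ : ∀ {n} {xs : List (Fin n)} → Unique xs → length xs ≤ n
unique⇒length≤ {n} {xs} xs! = subst₂ _≤_
  (sym (unique∧set⇒length xs! (filter⁺ ∈xs? (allFin⁺ n))
    (λ {z} → ∈-filter⁺ ∈xs? (∈-allFin z)) (proj₂ ∘ ∈-filter⁻ ∈xs? {xs = allFin n})))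
  (length-allFin n)
  (length-filter ∈xs? (allFin n))
  where
  ∈xs? : ∀ z → Dec (z ∈ xs)
  ∈xs? z = ∈? _≟_ z xs

∉⇒unique : ∀ {A : Set} {x : A} {xs} → x ∉ xs → Unique xs → Unique (x ∷ xs)
∉⇒unique x∉xs xs! = ¬Any⇒All¬ _ x∉xs ∷ xs!

∉⇒≢ : ∀ {A : Set} {x v : A} {vs} → v ∉ vs → x ∈ vs → x ≢ v
∉⇒≢ v∉vs x∈vs refl = v∉vs x∈vs

-- Growing a tree leaf by leaf.

module _ {n} (G : Graph n) where

  -- The list records every vertex in order, both ends included, so that it can be read as the
  -- `Linked` list of a cycle.
  data Walk : Fin n → List (Fin n) → Fin n → Set where
    stop : ∀ {x} → Walk x [ x ] x
    _∷_  : ∀ {x y z vs} → Adj G x y → Walk y vs z → Walk x (x ∷ vs) z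

  _∷ʳ_ : ∀ {x y z vs} → Walk x vs y → Adj G y z → Walk x (vs ++ [ z ]) z
  stop    ∷ʳ e = e ∷ stop
  (d ∷ p) ∷ʳ e = d ∷ (p ∷ʳ e)

  walk⇒linked : ∀ {x y vs} → Walk x vs y → Linked (Adj G) vs
  walk⇒linked stop            = [-]
  walk⇒linked (e ∷ stop)      = e ∷ [-]
  walk⇒linked (e ∷ p@(_ ∷ _)) = e ∷ walk⇒linked p

  -- With the vertex that closes the walk, this yields the three vertices required by `IsCycle`.
  walk-length≥2 : ∀ {x y vs} → x ≢ y → Walk x vs y → 2 ≤ length vs
  walk-length≥2 x≢y stop          = contradiction refl x≢y
  walk-length≥2 x≢y (_ ∷ stop)    = s≤s (s≤s z≤n)
  walk-length≥2 x≢y (_ ∷ (_ ∷ _)) = s≤s (s≤s z≤n)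

  -- Each edge is stored as (leaf, parent). The last premise of `leaf` is what acyclicity provides;
  -- the block count below works from it instead of from `Acyclic`.
  data Grown : List (Fin n) → List (Fin n × Fin n) → Set where
    root : ∀ r → Grown [ r ] []
    leaf : ∀ {u v vs es} → Grown vs es → v ∉ vs → u ∈ vs → Adj G v u →
           (∀ {w} → w ∈ vs → Adj G v w → w ≡ u) → Grown (v ∷ vs) ((v , u) ∷ es)

  grown-unique : ∀ {vs es} → Grown vs es → Unique vs
  grown-unique (root r)            = [] ∷ []
  grown-unique (leaf g v∉vs _ _ _) = ∉⇒unique v∉vs (grown-unique g)

  SimplePath : List (Fin n) → Fin n → Fin n → Set
  SimplePath vs x y = ∃ λ ps → Walk x ps y × Unique ps × (∀ {z} → z ∈ ps → z ∈ vs)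

  -- A path that starts or ends at the newest leaf is a path at its parent extended by one edge; it
  -- stays simple because the leaf is new.
  grown-path : ∀ {vs es} → Grown vs es → ∀ {x y} → x ∈ vs → y ∈ vs → SimplePath vs x y
  grown-path (root r) (here refl) (here refl) = [ r ] , stop , ([] ∷ []) , id
  grown-path (leaf {v = v} _ _ _ _ _) (here refl) (here refl) = [ v ] , stop , ([] ∷ []) , λ { (here refl) → here refl }
  grown-path (leaf {v = v} g v∉vs u∈vs e _) (here refl) (there y∈vs) =
    let ps , p , ps! , ps⊆vs = grown-path g u∈vs y∈vs
    in v ∷ ps , e ∷ p , ∉⇒unique (v∉vs ∘ ps⊆vs) ps! ,
       λ { (here refl) → here refl ; (there z∈ps) → there (ps⊆vs z∈ps) }
  grown-path (leaf {v = v} g v∉vs u∈vs e _) (there x∈vs) (here refl) =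
    let ps , p , ps! , ps⊆vs = grown-path g x∈vs u∈vs
    in ps ++ [ v ] , p ∷ʳ symm G e ,
       ++⁺ ps! ([] ∷ []) (λ { (z∈ps , here refl) → v∉vs (ps⊆vs z∈ps) }) ,
       λ z∈ → [ there ∘ ps⊆vs , (λ { (here refl) → here refl }) ]′ (∈-++⁻ ps z∈)
  grown-path (leaf g v∉vs _ _ _) (there x∈vs) (there y∈vs) =
    let ps , p , ps! , ps⊆vs = grown-path g x∈vs y∈vs
    in ps , p , ps! , there ∘ ps⊆vs

  -- Two neighbours of v in vs would close up, through v, a simple path inside vs to a cycle.
  acyclic⇒neighbour-unique : Acyclic G → ∀ {vs es} → Grown vs es → ∀ {u v w} → v ∉ vs →
    u ∈ vs → Adj G v u → w ∈ vs → Adj G v w → w ≡ u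
  acyclic⇒neighbour-unique acyclic g {u} {v} {w} v∉vs u∈vs vu w∈vs vw with w ≟ u
  ... | yes w≡u = w≡u
  ... | no  w≢u =
    let ps , p , ps! , ps⊆vs = grown-path g w∈vs u∈vs
    in contradiction
         (s≤s (walk-length≥2 w≢u p) , ∉⇒unique (v∉vs ∘ ps⊆vs) ps! , walk⇒linked (vw ∷ (p ∷ʳ symm G vu)))
         (acyclic v ps)

  -- Follow the path up to the first step that leaves `vs`.
  crossing-edge : ∀ vs {x y} → x ∈ vs → y ∉ vs → Reachable G x y →
    ∃₂ λ u v → u ∈ vs × v ∉ vs × Adj G u v
  crossing-edge vs x∈vs y∉vs ε = contradiction x∈vs y∉vs
  crossing-edge vs {x} x∈vs y∉vs (_◅_ {j = z} e p) with ∈? _≟_ z vs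
  ... | yes z∈vs = crossing-edge vs z∈vs y∉vs p
  ... | no  z∉vs = x , z , x∈vs , z∉vs , e

  grown-inhabited : ∀ {vs es} → Grown vs es → ∃ (_∈ vs)
  grown-inhabited (root r)                 = r , here refl
  grown-inhabited (leaf {v = v} _ _ _ _ _) = v , here refl

  Spanning : Set
  Spanning = ∃₂ λ vs es → Grown vs es × (∀ v → v ∈ vs)

  -- Recursion on fuel `m`: each new leaf lengthens `vs` by one and uses one unit. Fuel zero would
  -- force more than `n` distinct vertices.
  grow : IsTree G → ∀ m {vs es} → n < length vs ℕ.+ m → Grown vs es → Spanning
  grow _ zero {vs} n<length g =
    contradiction (subst (n <_) (ℕ.+-identityʳ (length vs)) n<length) (ℕ.≤⇒≯ (unique⇒length≤ (grown-unique g)))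
  grow tree@(connected , acyclic) (suc m) {vs} {es} n<length g with all? (λ v → ∈? _≟_ v vs)
  ... | yes all = vs , es , g , all
  ... | no ¬all =
    -- The missing vertex `y` need not be adjacent to `vs`; the leaf to attach is the outer end `v`
    -- of an edge crossing towards it.
    let y , y∉vs = ¬∀⟶∃¬ n (_∈ vs) (λ v → ∈? _≟_ v vs) ¬all
        x , x∈vs = grown-inhabited g
        u , v , u∈vs , v∉vs , uv = crossing-edge vs x∈vs y∉vs (connected x y)
        vu = symm G uv
    in grow tree m (subst (n <_) (ℕ.+-suc (length vs) m) n<length)
         (leaf g v∉vs u∈vs vu (acyclic⇒neighbour-unique acyclic g v∉vs u∈vs vu))

  spanning : IsTree G → Fin n → Spanning
  -- The root already counts for one, so with fuel `n` the bound reads `n < 1 + n`.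
  spanning tree r = grow tree n ℕ.≤-refl (root r)

  grown-length : ∀ {vs es} → Grown vs es → length vs ≡ suc (length es)
  grown-length (root r)         = refl
  grown-length (leaf g _ _ _ _) = cong suc (grown-length g)

  -- Distinct endpoints are what gives each edge the matching probability 1/k.
  grown-edges-≢ : ∀ {vs es} → Grown vs es → ∀ {u v} → (u , v) ∈ es → u ≢ v
  grown-edges-≢ (leaf _ v∉vs u∈vs _ _) (here refl) refl = v∉vs u∈vs
  grown-edges-≢ (leaf g _ _ _ _)       (there e∈es)     = grown-edges-≢ g e∈es

  spanning-length : ∀ {vs es} → Grown vs es → (∀ v → v ∈ vs) → length vs ≡ n
  spanning-length g ∈vs = trans
    (unique∧set⇒length (grown-unique g) (allFin⁺ n) (λ {z} _ → ∈-allFin z) (λ {z} _ → ∈vs z))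
    (length-allFin n)

  -- Components and their representatives.

  reachable-sym : ∀ {u v} → Reachable G u v → Reachable G v u
  reachable-sym = reverse (symm G)

  reachable⇒component≡ : ∀ {u v} → Reachable G u v → component G u ≡ component G v
  reachable⇒component≡ {u} {v} p = tabulate-cong λ w →
    does-⇔ (mk⇔ (reachable-sym p ◅◅_) (p ◅◅_)) (reachable? G u w) (reachable? G v w)

  -- Compare the two subsets at `v`: it belongs to its own component, hence to that of `u`.
  component≡⇒reachable : ∀ {u v} → component G u ≡ component G v → Reachable G u v
  component≡⇒reachable {u} {v} eq = witness (reachable? G u v) (begin
    does (reachable? G u v)    ≡⟨ lookup∘tabulate _ v ⟨
    lookup (component G u) v   ≡⟨ cong (λ s → lookup s v) eq ⟩
    lookup (component G v) v   ≡⟨ lookup∘tabulate _ v ⟩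
    does (reachable? G v v)    ≡⟨ dec-true (reachable? G v v) ε ⟩
    true                       ∎)
    where
    witness : ∀ {A : Set} (a? : Dec A) → does a? ≡ true → A
    witness (yes a) _ = a

  -- Once vs is everything, rep is constant on components, so it separates the vertices of reps.
  record Representatives (vs reps : List (Fin n)) : Set where
    field
      rep       : Fin n → Fin n
      unique    : Unique reps
      ⊆vs       : ∀ {r} → r ∈ reps → r ∈ vs
      fixed     : ∀ {r} → r ∈ reps → rep r ≡ r
      rep∈      : ∀ {v} → v ∈ vs → rep v ∈ reps
      connected : ∀ {v} → v ∈ vs → Reachable G v (rep v)
      invariant : ∀ {u v} → u ∈ vs → v ∈ vs → Adj G u v → rep u ≡ rep v

  -- `components G` and the components of `reps` are duplicate-free lists with the same entries:
  -- every vertex reaches its representative, and distinct representatives have distinct components.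
  length-components : ∀ {vs reps} → Representatives vs reps → (∀ v → v ∈ vs) →
    length (components G) ≡ length reps
  length-components {vs} {reps} R ∈vs = trans
    (unique∧set⇒length (deduplicate-! (≡-dec _≟ᵇ_) _) (map-component-unique id unique)
      (λ z∈ → let v , _ , z≡ = ∈-map⁻ (component G) (∈-deduplicate⁻ (≡-dec _≟ᵇ_) (map (component G) (allFin n)) z∈)
              in subst (_∈ map (component G) reps) (sym (trans z≡ (reachable⇒component≡ (connected (∈vs v)))))
                   (∈-map⁺ (component G) (rep∈ (∈vs v))))
      (λ z∈ → let r , _ , z≡ = ∈-map⁻ (component G) z∈
              in ∈-deduplicate⁺ (≡-dec _≟ᵇ_) (subst (_∈ map (component G) (allFin n)) (sym z≡)
                   (∈-map⁺ (component G) (∈-allFin r)))))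
    (length-map (component G) reps)
    where
    open Representatives R

    reachable⇒rep≡ : ∀ {u v} → Reachable G u v → rep u ≡ rep v
    reachable⇒rep≡ ε       = refl
    reachable⇒rep≡ (e ◅ p) = trans (invariant (∈vs _) (∈vs _) e) (reachable⇒rep≡ p)

    component-injective : ∀ {r s} → r ∈ reps → s ∈ reps → component G r ≡ component G s → r ≡ s
    component-injective r∈ s∈ eq =
      trans (sym (fixed r∈)) (trans (reachable⇒rep≡ (component≡⇒reachable eq)) (fixed s∈))

    -- Stated for any `rs` within `reps`, so that the induction can drop the head.
    map-component-unique : ∀ {rs} → (∀ {r} → r ∈ rs → r ∈ reps) → Unique rs → Unique (map (component G) rs)
    map-component-unique {[]}     _    _ = []
    map-component-unique {r ∷ rs} rs⊆ (r∉ ∷ rs!) = ∉⇒unique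
      (λ z∈ → let s , s∈ , eq = ∈-map⁻ (component G) z∈
              in All.lookup r∉ s∈ (component-injective (rs⊆ (here refl)) (rs⊆ (there s∈)) eq))
      (map-component-unique (rs⊆ ∘ there) rs!)

-- Blocks and monochromatic edges of a fixed coloring.

monochromaticEdges : ∀ {n k} → Coloring n k → List (Fin n × Fin n) → ℕ
monochromaticEdges c es = ListAction.sum (map (uncurry λ u v → ⟦ c u ≟ c v ⟧) es)

module _ {n k} (G : Graph n) (c : Coloring n k) where

  private H = monochromatic G c

  -- Each new leaf adds one to exactly one summand: to the edges if it has its parent's color, to
  -- the representatives otherwise.
  representatives : ∀ {vs es} → Grown G vs es →
    ∃ λ reps → Representatives H vs reps × length reps ℕ.+ monochromaticEdges c es ≡ length vs
  representatives (root r) = [ r ] , record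
    { rep       = id
    ; unique    = [] ∷ []
    ; ⊆vs       = id
    ; fixed     = λ _ → refl
    ; rep∈      = id
    ; connected = λ _ → ε
    ; invariant = λ { (here refl) (here refl) _ → refl }
    } , refl
  representatives (leaf {u} {v} {vs} {es} g v∉vs u∈vs vu parent) with representatives g | c v ≟ c u
  -- The leaf joins its parent's block and takes over that representative.
  ... | reps , R , eq | yes cv≡cu = reps , record
    { rep       = rep′
    ; unique    = unique
    ; ⊆vs       = there ∘ ⊆vs
    ; fixed     = λ r∈ → trans (rep′-old (⊆vs r∈)) (fixed r∈)
    ; rep∈      = λ { (here refl) → subst (_∈ reps) (sym rep′-new) (rep∈ u∈vs)
                    ; (there x∈)  → subst (_∈ reps) (sym (rep′-old x∈)) (rep∈ x∈) }
    ; connected = λ { (here refl) → subst (Reachable H _) (sym rep′-new) ((vu , cv≡cu) ◅ connected u∈vs)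
                    ; (there x∈)  → subst (Reachable H _) (sym (rep′-old x∈)) (connected x∈) }
    ; invariant = λ { (here refl) (here refl) _       → refl
                    ; (here refl) (there y∈)  (e , _) → new-old y∈ e
                    ; (there x∈)  (here refl) (e , _) → sym (new-old x∈ (symm G e))
                    ; (there x∈)  (there y∈)  e       → trans (rep′-old x∈) (trans (invariant x∈ y∈ e) (sym (rep′-old y∈))) }
    } , trans (ℕ.+-suc (length reps) _) (cong suc eq)
    where
    open Representatives R
    rep′ = updateAt rep v (const (rep u))
    rep′-new : rep′ v ≡ rep u
    rep′-new = updateAt-updates v rep
    rep′-old : ∀ {x} → x ∈ vs → rep′ x ≡ rep x
    rep′-old x∈ = updateAt-minimal _ v rep (∉⇒≢ v∉vs x∈)
    -- By `parent`, the neighbour `y` can only be `u`, whose representative `v` has taken.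
    new-old : ∀ {y} → y ∈ vs → Adj G v y → rep′ v ≡ rep′ y
    new-old y∈ e = trans rep′-new (trans (cong rep (sym (parent y∈ e))) (sym (rep′-old y∈)))
  -- The leaf opens a new block and represents itself.
  ... | reps , R , eq | no cv≢cu = v ∷ reps , record
    { rep       = rep′
    ; unique    = ∉⇒unique (v∉vs ∘ ⊆vs) unique
    ; ⊆vs       = λ { (here refl) → here refl ; (there r∈) → there (⊆vs r∈) }
    ; fixed     = λ { (here refl) → rep′-new ; (there r∈) → trans (rep′-old (⊆vs r∈)) (fixed r∈) }
    ; rep∈      = λ { (here refl) → here rep′-new
                    ; (there x∈)  → there (subst (_∈ reps) (sym (rep′-old x∈)) (rep∈ x∈)) }
    ; connected = λ { (here refl) → subst (Reachable H _) (sym rep′-new) ε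
                    ; (there x∈)  → subst (Reachable H _) (sym (rep′-old x∈)) (connected x∈) }
    ; invariant = λ { (here refl) (here refl) _       → refl
                    ; (here refl) (there y∈)  (e , q) → isolated y∈ e q
                    ; (there x∈)  (here refl) (e , q) → sym (isolated x∈ (symm G e) (sym q))
                    ; (there x∈)  (there y∈)  e       → trans (rep′-old x∈) (trans (invariant x∈ y∈ e) (sym (rep′-old y∈))) }
    } , cong suc eq
    where
    open Representatives R
    rep′ = updateAt rep v (const v)
    rep′-new : rep′ v ≡ v
    rep′-new = updateAt-updates v rep
    rep′-old : ∀ {x} → x ∈ vs → rep′ x ≡ rep x
    rep′-old x∈ = updateAt-minimal _ v rep (∉⇒≢ v∉vs x∈)
    -- Vacuous: the only possible neighbour is `u`, whose color differs.
    isolated : ∀ {y} → y ∈ vs → Adj G v y → c v ≡ c y → rep′ v ≡ rep′ y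
    isolated y∈ e q = contradiction (trans q (cong c (parent y∈ e))) cv≢cu

  -- The relation between components, edges and vertices of a forest, applied to the monochromatic
  -- edges and kept free of subtraction.
  blocks+monochromaticEdges : ∀ {vs es} → Grown G vs es → (∀ v → v ∈ vs) → X k G c ℕ.+ monochromaticEdges c es ≡ n
  blocks+monochromaticEdges {vs} {es} g ∈vs =
    let reps , R , eq = representatives g in begin
    X k G c ℕ.+ monochromaticEdges c es       ≡⟨ cong (ℕ._+ monochromaticEdges c es) (length-components H R ∈vs) ⟩
    length reps ℕ.+ monochromaticEdges c es   ≡⟨ eq ⟩
    length vs                                 ≡⟨ spanning-length G g ∈vs ⟩
    n                                         ∎

-- Summation over all colorings.

-- Linearity of expectation along the edge list, with the factor `k` clearing the denominator.
∑ᶜ-monochromaticEdges : ∀ {n} k (es : List (Fin n × Fin n)) → (∀ {u v} → (u , v) ∈ es → u ≢ v) →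
  k ℕ.* ∑ᶜ k (λ c → monochromaticEdges c es) ≡ length es ℕ.* k ^ n
∑ᶜ-monochromaticEdges {n} k [] _ = trans (cong (k ℕ.*_) (trans (sum-const (k ^ n) 0) (ℕ.*-zeroʳ (k ^ n)))) (ℕ.*-zeroʳ k)
∑ᶜ-monochromaticEdges {n} k ((u , v) ∷ es) es≢ = begin
  k ℕ.* ∑ᶜ k (λ c → ⟦ c u ≟ c v ⟧ ℕ.+ monochromaticEdges c es)
    ≡⟨ cong (k ℕ.*_) (∑-distrib-+ {k ^ n} _ _) ⟩
  k ℕ.* (∑ᶜ k (λ c → ⟦ c u ≟ c v ⟧) ℕ.+ ∑ᶜ k (λ c → monochromaticEdges c es))
    ≡⟨ ℕ.*-distribˡ-+ k _ _ ⟩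
  k ℕ.* ∑ᶜ k (λ c → ⟦ c u ≟ c v ⟧) ℕ.+ k ℕ.* ∑ᶜ k (λ c → monochromaticEdges c es)
    ≡⟨ cong₂ ℕ._+_ (∑ᶜ-⟦≟⟧ k (es≢ (here refl))) (∑ᶜ-monochromaticEdges k es (es≢ ∘ there)) ⟩
  suc (length es) ℕ.* k ^ n ∎

∑ᶜ-X : ∀ k n (T : Graph (suc n)) → IsTree T →
  suc k ℕ.* ∑ᶜ (suc k) (X (suc k) T) ≡ (k ℕ.* suc n ℕ.+ 1) ℕ.* suc k ^ suc n
∑ᶜ-X k n T tree with vs , es , g , ∈vs ← spanning T tree zero =
  -- A tree on `suc n` vertices has `n` edges; their total share `n ℕ.* K` is added to both sides to
  -- avoid subtraction.
  ℕ.+-cancelʳ-≡ (n ℕ.* K) _ _ (begin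
  k′ ℕ.* ∑ᶜ k′ (X k′ T) ℕ.+ n ℕ.* K
    ≡⟨ cong (λ m → k′ ℕ.* ∑ᶜ k′ (X k′ T) ℕ.+ m ℕ.* K) length-es ⟨
  k′ ℕ.* ∑ᶜ k′ (X k′ T) ℕ.+ length es ℕ.* K
    ≡⟨ cong (λ m → k′ ℕ.* ∑ᶜ k′ (X k′ T) ℕ.+ m) (∑ᶜ-monochromaticEdges k′ es (grown-edges-≢ T g)) ⟨
  k′ ℕ.* ∑ᶜ k′ (X k′ T) ℕ.+ k′ ℕ.* ∑ᶜ k′ (λ c → monochromaticEdges c es)
    ≡⟨ ℕ.*-distribˡ-+ k′ (∑ᶜ k′ (X k′ T)) _ ⟨
  k′ ℕ.* (∑ᶜ k′ (X k′ T) ℕ.+ ∑ᶜ k′ (λ c → monochromaticEdges c es))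
    ≡⟨ cong (k′ ℕ.*_) (∑-distrib-+ {K} _ _) ⟨
  k′ ℕ.* ∑ᶜ k′ (λ c → X k′ T c ℕ.+ monochromaticEdges c es)
    ≡⟨ cong (k′ ℕ.*_) (sum-cong-≗ {K} λ i → blocks+monochromaticEdges T (coloring (suc n) k′ i) g ∈vs) ⟩
  k′ ℕ.* ∑ᶜ {suc n} k′ (λ _ → suc n)
    ≡⟨ cong (k′ ℕ.*_) (sum-const K (suc n)) ⟩
  k′ ℕ.* (K ℕ.* suc n)
    ≡⟨ rearrange k n K ⟩
  (k ℕ.* suc n ℕ.+ 1) ℕ.* K ℕ.+ n ℕ.* K ∎)
  where
  k′ = suc k
  K = k′ ^ suc n
  length-es : length es ≡ n
  length-es = ℕ.suc-injective (trans (sym (grown-length T g)) (spanning-length T g ∈vs))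
  rearrange : ∀ k n K → suc k ℕ.* (K ℕ.* suc n) ≡ (k ℕ.* suc n ℕ.+ 1) ℕ.* K ℕ.+ n ℕ.* K
  rearrange = solve-∀

-- From counts to rational expectations.

-- Unnormalised fractions add by the plain formula on numerators and denominators; this carries such
-- computations over to `ℚ`.
fromℚᵘ-homo-+ : ∀ p q → fromℚᵘ (p ℚᵘ.+ q) ≡ fromℚᵘ p ℚ.+ fromℚᵘ q
fromℚᵘ-homo-+ p q = ℚ.toℚᵘ-injective (ℚᵘ.≃-trans (ℚ.toℚᵘ-fromℚᵘ (p ℚᵘ.+ q)) (ℚᵘ.≃-sym
  (ℚᵘ.≃-trans (ℚ.toℚᵘ-homo-+ (fromℚᵘ p) (fromℚᵘ q)) (ℚᵘ.+-cong (ℚ.toℚᵘ-fromℚᵘ p) (ℚ.toℚᵘ-fromℚᵘ q)))))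

fromℚᵘ-homo-* : ∀ p q → fromℚᵘ (p ℚᵘ.* q) ≡ fromℚᵘ p ℚ.* fromℚᵘ q
fromℚᵘ-homo-* p q = ℚ.toℚᵘ-injective (ℚᵘ.≃-trans (ℚ.toℚᵘ-fromℚᵘ (p ℚᵘ.* q)) (ℚᵘ.≃-sym
  (ℚᵘ.≃-trans (ℚ.toℚᵘ-homo-* (fromℚᵘ p) (fromℚᵘ q)) (ℚᵘ.*-cong (ℚ.toℚᵘ-fromℚᵘ p) (ℚ.toℚᵘ-fromℚᵘ q)))))

fromℕ : ℕ → ℚ
fromℕ m = + m / 1

fromℕ-+ : ∀ a b → fromℕ (a ℕ.+ b) ≡ fromℕ a ℚ.+ fromℕ b
fromℕ-+ a b = trans
  (ℚ./-cong (cong₂ _+_ (sym (ℤ.*-identityʳ (+ a))) (sym (ℤ.*-identityʳ (+ b)))) refl)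
  (fromℚᵘ-homo-+ (mkℚᵘ (+ a) 0) (mkℚᵘ (+ b) 0))

fromℕ-* : ∀ a b → fromℕ (a ℕ.* b) ≡ fromℕ a ℚ.* fromℕ b
fromℕ-* a b = trans (ℚ./-cong (ℤ.pos-* a b) refl) (fromℚᵘ-homo-* (mkℚᵘ (+ a) 0) (mkℚᵘ (+ b) 0))

/-fromℕ : ∀ a k → + a / suc k ≡ fromℕ a ℚ.* (+ 1 / suc k)
/-fromℕ a k = trans
  (ℚ./-cong (sym (ℤ.*-identityʳ (+ a))) (sym (ℕ.*-identityˡ (suc k))))
  (fromℚᵘ-homo-* (mkℚᵘ (+ a) 0) (mkℚᵘ (+ 1) k))

n/n≡1 : ∀ k → + suc k / suc k ≡ 1ℚ
n/n≡1 k = ℚ.fromℚᵘ-cong {mkℚᵘ (+ suc k) k} {mkℚᵘ (+ 1) 0} (*≡* (ℤ.*-comm (+ suc k) (+ 1)))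

∑-*-fromℕ : ∀ {m} p (f : Fin m → ℕ) → ∑ (λ i → p ℚ.* fromℕ (f i)) ≡ p ℚ.* fromℕ (sum f)
∑-*-fromℕ {zero}  p f = sym (ℚ.*-zeroʳ p)
∑-*-fromℕ {suc m} p f = begin
  p ℚ.* fromℕ (f zero) ℚ.+ ∑ (λ i → p ℚ.* fromℕ (f (suc i)))     ≡⟨ cong (p ℚ.* fromℕ (f zero) ℚ.+_) (∑-*-fromℕ p (f ∘ suc)) ⟩
  p ℚ.* fromℕ (f zero) ℚ.+ p ℚ.* fromℕ (sum (f ∘ suc))           ≡⟨ ℚ.*-distribˡ-+ p _ _ ⟨
  p ℚ.* (fromℕ (f zero) ℚ.+ fromℕ (sum (f ∘ suc)))               ≡⟨ cong (p ℚ.*_) (fromℕ-+ (f zero) _) ⟨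
  p ℚ.* fromℕ (sum f)                                            ∎

-- The product measure has total mass one: `suc k ^ n` colorings, all of the same probability.
∏-uniform : ∀ n k → ∏ {n} (λ _ → + 1 / suc k) ℚ.* fromℕ (suc k ^ n) ≡ 1ℚ
∏-uniform zero    k = refl
∏-uniform (suc n) k = begin
  (u ℚ.* p) ℚ.* fromℕ (suc k ℕ.* suc k ^ n)           ≡⟨ cong ((u ℚ.* p) ℚ.*_) (fromℕ-* (suc k) (suc k ^ n)) ⟩
  (u ℚ.* p) ℚ.* (fromℕ (suc k) ℚ.* fromℕ (suc k ^ n)) ≡⟨ interchange u p _ _ ⟩
  (u ℚ.* fromℕ (suc k)) ℚ.* (p ℚ.* fromℕ (suc k ^ n)) ≡⟨ cong₂ ℚ._*_ (trans (ℚ.*-comm u _) (trans (sym (/-fromℕ (suc k) k)) (n/n≡1 k))) (∏-uniform n k) ⟩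
  1ℚ ℚ.* 1ℚ                                           ≡⟨⟩
  1ℚ                                                  ∎
  where
  u = + 1 / suc k
  p = ∏ {n} (λ _ → + 1 / suc k)

-- The hypothesis is the claim with denominators cleared. Inserting `fromℕ (suc k) ℚ.* u`, which is
-- one, lets it be applied.
𝔼-from-∑ᶜ : ∀ {n} k (f : Coloring n (suc k) → ℕ) m → suc k ℕ.* ∑ᶜ (suc k) f ≡ m ℕ.* suc k ^ n →
  𝔼 (suc k) f ≡ + m / suc k
𝔼-from-∑ᶜ {n} k f m eq = begin
  𝔼 (suc k) f
    -- `uniform` ignores its color argument, so the probability of every coloring unfolds to the
    -- constant `p`.
    ≡⟨ ∑-*-fromℕ p (λ i → f (coloring n (suc k) i)) ⟩
  p ℚ.* fromℕ N
    ≡⟨ ℚ.*-identityʳ _ ⟨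
  (p ℚ.* fromℕ N) ℚ.* 1ℚ
    ≡⟨ cong ((p ℚ.* fromℕ N) ℚ.*_) (trans (sym (n/n≡1 k)) (/-fromℕ (suc k) k)) ⟩
  (p ℚ.* fromℕ N) ℚ.* (fromℕ (suc k) ℚ.* u)
    ≡⟨ ℚ.*-assoc (p ℚ.* fromℕ N) _ u ⟨
  ((p ℚ.* fromℕ N) ℚ.* fromℕ (suc k)) ℚ.* u
    ≡⟨ cong (ℚ._* u) (ℚ.*-assoc p _ _) ⟩
  (p ℚ.* (fromℕ N ℚ.* fromℕ (suc k))) ℚ.* u
    ≡⟨ cong (λ x → (p ℚ.* x) ℚ.* u) (begin
      fromℕ N ℚ.* fromℕ (suc k)       ≡⟨ fromℕ-* N (suc k) ⟨
      fromℕ (N ℕ.* suc k)             ≡⟨ cong fromℕ (trans (ℕ.*-comm N (suc k)) (trans eq (ℕ.*-comm m (suc k ^ n)))) ⟩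
      fromℕ (suc k ^ n ℕ.* m)         ≡⟨ fromℕ-* (suc k ^ n) m ⟩
      fromℕ (suc k ^ n) ℚ.* fromℕ m   ∎) ⟩
  (p ℚ.* (fromℕ (suc k ^ n) ℚ.* fromℕ m)) ℚ.* u
    ≡⟨ cong (ℚ._* u) (ℚ.*-assoc p _ _) ⟨
  ((p ℚ.* fromℕ (suc k ^ n)) ℚ.* fromℕ m) ℚ.* u
    ≡⟨ cong (λ x → (x ℚ.* fromℕ m) ℚ.* u) (∏-uniform n k) ⟩
  (1ℚ ℚ.* fromℕ m) ℚ.* u
    ≡⟨ cong (ℚ._* u) (ℚ.*-identityˡ (fromℕ m)) ⟩
  fromℕ m ℚ.* u
    ≡⟨ /-fromℕ m k ⟨
  + m / suc k ∎
  where
  N = ∑ᶜ (suc k) f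
  u = + 1 / suc k
  p = ∏ {n} (λ _ → + 1 / suc k)

corollary2p4 : ∀ (k n : ℕ) .{{_ : NonZero k}} .{{_ : NonZero n}} (T : Graph n) → IsTree T →
    𝔼 k (X k T) ≡ ((+ k - + 1) * + n + + 1) / k
corollary2p4 (suc k) (suc n) T tree =
  trans (𝔼-from-∑ᶜ k (X (suc k) T) (k ℕ.* suc n ℕ.+ 1) (∑ᶜ-X k n T tree))
        -- `+ suc k - + 1` computes to `+ k`; only the product has to be carried from `ℕ` to the
        -- integers.
        (cong (λ m → (m + + 1) / suc k) (ℤ.pos-* k (suc n)))
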